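{- Let $q_n$ denote the $n$th prime number. For any $\delta\in\mathbb{Z}$ with $\delta\ge 3$, there exist infinitely many primitive covering numbers of the form $2^{\beta}q_kq_{k+1}$, where $k\ge 1$ and $\beta\ge 0$ are integers with $\beta\le q_k-3$. Consequently, each such primitive covering number fails to satisfy Sun's condition, that is, it cannot be written as $p_1^{a_1}\cdots p_r^{a_r}$ with $p_1,\dots,p_r$ distinct primes (in any order) and $a_1,\dots,a_r$ positive integers such that $$\prod_{0<t<s}(a_t+1)\ \ge\ p_s-1+\delta_{r,s}\qquad\text{for all } s=1,2,\dots,r,$$ where $\delta_{r,s}$ is Kronecker's delta and the empty product is $1$; thus each such number is a counterexample to the conjecture of Sun that every primitive covering number can be written in this way.
   Context: A covering is a finite collection of congruences $z\equiv x_i\pmod{m_i}$, with integers $x_i\ge 0$, $m_i\ge 2$, such that every integer satisfies at least one of the congruences; the moduli $m_i$ are assumed pairwise distinct. A positive integer $L$ is a covering number if there exists a covering whose moduli are distinct divisors $d>1$ of $L$. A covering number $L$ is a primitive covering number if no proper divisor of $L$ is a covering number. Sun's conjecture: any primitive covering number can be written as $p_1^{a_1}\cdots p_r^{a_r}$, where $p_1,\dots,p_r$ are distinct primes and $a_1,\dots,a_r$ are positive integers satisfying the displayed inequalities. (The symbol $\delta_{r,s}$ is Kronecker's delta and is unrelated to the integer $\delta$.) -}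

module Defs where

open import Data.Bool.Base using (if_then_else_)
open import Data.Fin.Base using (Fin; Fin′; inject; toℕ)
open import Data.Integer.Base as ℤ using (ℤ; +_)
import Data.Integer.Divisibility as ℤ
open import Data.List.Base using (List; []; _∷_; map)
open import Data.List.Relation.Unary.All using (All; _∷_)
open import Data.List.Relation.Unary.Any using (Any)
open import Data.List.Relation.Unary.Unique.Propositional using (Unique)
open import Data.Nat.Base
open import Data.Nat.Divisibility
open import Data.Nat.Primality using (Prime; prime?; prime⇒nonZero; ¬prime[1])
open import Data.Nat.Primality.Factorisation using (factorise)
open import Data.Nat.Properties
open import Data.Product.Base using (_×_; _,_; ∃; proj₁; proj₂)
open import Algebra.Properties.CommutativeMonoid.Sum *-1-commutativeMonoid
  using () renaming (sum to ∏)
open import Function.Definitions using (Injective)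
open import Relation.Binary.PropositionalEquality
open import Relation.Nullary using (¬_; Dec; yes; no; contradiction)

Infinite : (ℕ → Set) → Set
Infinite P = ∀ N → ∃ λ n → N < n × P n

record Congruence : Set where
  field
    residue   : ℕ
    modulus   : ℕ
    modulus≥2 : 2 ≤ modulus

open Congruence public

_Satisfies_ : ℤ → Congruence → Set
z Satisfies c = + modulus c ℤ.∣ z ℤ.- + residue c

record IsCovering (cs : List Congruence) : Set where
  field
    distinct : Unique (map modulus cs)
    covers   : ∀ (z : ℤ) → Any (z Satisfies_) cs

IsCoveringNumber : ℕ → Set
IsCoveringNumber L =
  0 < L × ∃ λ cs → IsCovering cs × All (λ c → modulus c ∣ L) cs

IsPrimitiveCoveringNumber : ℕ → Set
IsPrimitiveCoveringNumber L =
  IsCoveringNumber L × (∀ d → d ∣ L → d ≢ L → ¬ IsCoveringNumber d)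

private
  least : ∀ {P : ℕ → Set} → (∀ n → Dec (P n)) → ∀ d n → P (d + n) →
          ∃ λ m → n ≤ m × P m × (∀ j → n ≤ j → P j → m ≤ j)
  least P? zero n pn = n , ≤-refl , pn , λ _ n≤j _ → n≤j
  least {P} P? (suc d) n pn with P? n
  ... | yes p = n , ≤-refl , p , λ _ n≤j _ → n≤j
  ... | no ¬p with least P? d (suc n) (subst P (sym (+-suc d n)) pn)
  ...   | m , n<m , pm , min = m , <⇒≤ n<m , pm , λ j n≤j pj →
          min j (≤∧≢⇒< n≤j λ { refl → ¬p pj }) pj

  primeAbove : ∀ n → ∃ λ p → n < p × Prime p
  primeAbove n with factorise (suc (n !))
  ... | record { factors = [] ; isFactorisation = eq } =
        contradiction (suc-injective eq) (≢-nonZero⁻¹ (n !) {{n !≢0}})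
  ... | record { factors = p ∷ ps ; isFactorisation = eq ; factorsPrime = pp ∷ _ }
      with n <? p
  ...   | yes n<p = p , n<p , pp
  ...   | no  n≮p = contradiction (subst Prime p≡1 pp) ¬prime[1]
    where
    p∣n! : p ∣ n !
    p∣n! = ∣-trans (n∣n! p {{prime⇒nonZero pp}}) (m≤n⇒m!∣n! (≮⇒≥ n≮p))
      where
      n∣n! : ∀ m → .{{NonZero m}} → m ∣ m !
      n∣n! (suc m) = m∣m*n (m !)
    p≡1 : p ≡ 1
    p≡1 = ∣1⇒≡1 (∣m+n∣m⇒∣n
      (subst (p ∣_) (trans (sym eq) (+-comm 1 (n !))) (m∣m*n _)) p∣n!)

leastPrimeAbove : ∀ n → ∃ λ p → n < p × Prime p ×
                  (∀ p′ → n < p′ → Prime p′ → p ≤ p′)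
leastPrimeAbove n with primeAbove n
... | p , n<p , pp =
  least prime? (p ∸ suc n) (suc n) (subst Prime (sym (m∸n+n≡m n<p)) pp)

-- The primes are enumerated from 1.
q : (n : ℕ) → .{{NonZero n}} → ℕ
q 1             = 2
q (suc (suc n)) = proj₁ (leastPrimeAbove (q (suc n)))

-- The bound on β is stated over ℤ to avoid truncated subtraction.
record HasForm2^βq[k]q[k+1] (L : ℕ) : Set where
  field
    k β       : ℕ
    {{k≢0}}   : NonZero k
    β≤q[k]-3  : + β ℤ.≤ + q k ℤ.- + 3
    L≡        : L ≡ 2 ^ β * q k * q (suc k)

kronecker : ℕ → ℕ → ℕ
kronecker m n = if m ≡ᵇ n then 1 else 0

-- Here ∏ is the sum of the multiplicative monoid of ℕ.  Positions are numbered
-- from 0 in Fin r, so s stands for the 1-based index suc (toℕ s); Fin′ s is the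
-- set of positions before s.
record SunCondition (L : ℕ) : Set where
  field
    r          : ℕ
    p a        : Fin r → ℕ
    primes     : ∀ i → Prime (p i)
    distinct   : Injective _≡_ _≡_ p
    positive   : ∀ i → 0 < a i
    L≡         : L ≡ ∏ (λ i → p i ^ a i)
    inequality : ∀ (s : Fin r) →
      ∏ (λ (t : Fin′ s) → a (inject t) + 1) ≥ (p s ∸ 1) + kronecker r (suc (toℕ s))

SunConjecture : Set
SunConjecture = ∀ L → IsPrimitiveCoveringNumber L → SunCondition L

module Submission where

open import Data.Empty using (⊥; ⊥-elim)
open import Data.Fin.Base as Fin using (Fin; toℕ; fromℕ<)
open import Data.Fin.Properties as Fin using (toℕ<n; toℕ-fromℕ<; fromℕ<-toℕ; pigeonhole)
open import Data.Integer.Base as ℤ using (ℤ; +_; _≤_)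
import Data.Integer.Divisibility as ℤ
open import Data.Integer.Divisibility.Signed as Signed using (∣ᵤ⇒∣; ∣⇒∣ᵤ)
open import Data.Integer.DivMod using (_%ℕ_; _/ℕ_; n%ℕd<d; a≡a%ℕn+[a/ℕn]*n)
import Data.Integer.Properties as ℤ
import Data.Integer.Tactic.RingSolver as ℤ-Ring
open import Data.List.Base using (List; []; _∷_; map; filter; upTo)
open import Data.List.Membership.Propositional using (_∈_; find; lose)
open import Data.List.Membership.Propositional.Properties using (∈-filter⁺; ∈-upTo⁺; ∈-map⁺)
import Data.List.Properties as List
open import Data.List.Relation.Unary.All as All using (_∷_)
import Data.List.Relation.Unary.All.Properties as All
open import Data.List.Relation.Unary.AllPairs using (_∷_)
open import Data.List.Relation.Unary.Any using (Any; here; there)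
open import Data.List.Relation.Unary.Unique.Propositional using (Unique)
import Data.List.Relation.Unary.Unique.Propositional.Properties as Unique
open import Data.Nat.Base as ℕ hiding (_≤_)
open import Data.Nat.Coprimality as Coprime using (Coprime; coprime-divisor; coprime-Bézout)
open import Data.Nat.Divisibility
open import Data.Nat.DivMod
  using (m*n/n≡m; +-distrib-/-∣ʳ; m<n⇒m/n≡0; m<n⇒m%n≡m; [m+kn]%n≡m%n)
open import Data.Nat.GCD using (module Bézout)
open import Data.Nat.Logarithm using (⌊log₂_⌋; ⌊log₂[2^n]⌋≡n)
open import Data.Nat.Primality
  using (Prime; euclidsLemma; prime⇒irreducible; prime⇒nonTrivial; prime⇒nonZero; prime[2]; ¬prime[1])
open import Data.Nat.Primality.Factorisation using (factorise)
open import Data.Nat.Properties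
import Data.Nat.Tactic.RingSolver as ℕ-Ring
open import Data.Product.Base using (_×_; _,_; ∃; ∃₂; proj₁; proj₂)
open import Data.Sum.Base using (_⊎_; inj₁; inj₂; [_,_]′)
open import Data.Vec.Base using (Vec; []; _∷_; lookup; tabulate)
open import Data.Vec.Properties using (lookup∘tabulate)
open import Function.Base using (_∘_; _$_; case_of_)
open import Relation.Binary.Definitions using (tri<; tri≈; tri>)
open import Relation.Binary.PropositionalEquality
open import Relation.Nullary using (¬_; Dec; yes; no; contradiction)
open import Relation.Nullary.Decidable using (map′; _×-dec_)
open import Defs

-- Let p < p′ be consecutive odd primes.  On the class left uncovered by the moduli 2, …, 2^β, the
-- modulus 2^i p (i ≤ β) meets one class mod p, 2^i p′ one class mod p′, and 2^i p p′ one class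
-- mod p p′; so 2^β p p′ is a covering number as soon as (p - 1 - β)(p′ - 1 - β) ≤ β + 1, while
-- 2^γ p is none for γ + 1 < p.  For β = p - 3 the condition reads 2 p′ + 6 ≤ 3 p, and the least
-- β for which 2^β p p′ is a covering number then yields a primitive one.  The condition holds for
-- infinitely many p, because otherwise the primes would grow geometrically, which contradicts a
-- count of prime divisors along an arithmetic progression.  Sun's condition forces p₁ = 2, and then
-- a₁ + 1 ≥ p₂ - 1 ≥ p - 1 ≥ β + 2 although a₁ ≤ β.

-- Congruences between integers

-- A record keeps `d`, `x` and `y` inferable, which the unfolded absolute value of `x - y` would
-- not.
record Congruent (d : ℕ) (x y : ℤ) : Set where
  constructor congruent
  field divides-difference : + d ℤ.∣ x ℤ.- y

open Congruent

private
  signed : ∀ {d x y} → Congruent d x y → + d Signed.∣ x ℤ.- y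
  signed (congruent p) = ∣ᵤ⇒∣ p

  unsigned : ∀ {d x y z} → z ≡ x ℤ.- y → + d Signed.∣ z → Congruent d x y
  unsigned refl p = congruent (∣⇒∣ᵤ p)

congruent-trans : ∀ {d x y z} → Congruent d x y → Congruent d y z → Congruent d x z
congruent-trans {x = x} {y} {z} p q =
  unsigned (lem x y z) (Signed.∣m∣n⇒∣m+n (signed p) (signed q))
  where
  lem : ∀ x y z → (x ℤ.- y) ℤ.+ (y ℤ.- z) ≡ x ℤ.- z
  lem = ℤ-Ring.solve-∀

congruent-sym : ∀ {d x y} → Congruent d x y → Congruent d y x
congruent-sym {x = x} {y} p = unsigned (lem x y) (Signed.∣m⇒∣-m (signed p))
  where
  lem : ∀ x y → ℤ.- (x ℤ.- y) ≡ y ℤ.- x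
  lem = ℤ-Ring.solve-∀

congruent-∣ : ∀ {d e x y} → d ∣ e → Congruent e x y → Congruent d x y
congruent-∣ d∣e (congruent p) = congruent (∣-trans d∣e p)

congruent-+* : ∀ {d} x y → Congruent d (x ℤ.+ y ℤ.* + d) x
congruent-+* {d} x y = unsigned (lem x y (+ d)) (Signed.divides y refl)
  where
  lem : ∀ x y d → y ℤ.* d ≡ (x ℤ.+ y ℤ.* d) ℤ.- x
  lem = ℤ-Ring.solve-∀

congruent-%ℕ : ∀ z d .{{_ : NonZero d}} → Congruent d z (+ (z %ℕ d))
congruent-%ℕ z d = subst (λ x → Congruent d x (+ (z %ℕ d))) (sym (a≡a%ℕn+[a/ℕn]*n z d))
  (congruent-+* (+ (z %ℕ d)) (z /ℕ d))

congruent-*ˡ : ∀ {d} m {x y} → Congruent d x y → Congruent (m * d) (+ m ℤ.* x) (+ m ℤ.* y)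
congruent-*ˡ {d} m {x} {y} p = unsigned (lem (+ m) x y) $
  subst (Signed._∣ (+ m ℤ.* (x ℤ.- y))) (sym (ℤ.pos-* m d)) $
  Signed.*-monoʳ-∣ (+ m) (signed p)
  where
  lem : ∀ m x y → m ℤ.* (x ℤ.- y) ≡ m ℤ.* x ℤ.- m ℤ.* y
  lem = ℤ-Ring.solve-∀

congruent? : ∀ d x y → Dec (Congruent d x y)
congruent? d x y = map′ congruent divides-difference (d ∣? ℤ.∣ x ℤ.- y ∣)

-- Coverings as residue assignments

-- A covering by all divisors of L at once: r assigns a residue to every modulus.
Covers : ℕ → (ℕ → ℕ) → Set
Covers L r = ∀ z → ∃ λ d → 2 ℕ.≤ d × d ∣ L × Congruent d z (+ r d)

-- A divisor that occurs as no modulus gets the residue 0; an extra class cannot uncover anything.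
residueOf : List Congruence → ℕ → ℕ
residueOf []       d = 0
residueOf (c ∷ cs) d with modulus c ≟ d
... | yes _ = residue c
... | no  _ = residueOf cs d

residueOf-∈ : ∀ {cs c} → Unique (map modulus cs) → c ∈ cs →
              residueOf cs (modulus c) ≡ residue c
residueOf-∈ {c ∷ cs} _ (here refl) with modulus c ≟ modulus c
... | yes _ = refl
... | no c≢c = contradiction refl c≢c
residueOf-∈ {c′ ∷ cs} {c} (≢cs ∷ u) (there c∈) with modulus c′ ≟ modulus c
... | yes eq = contradiction eq (All.lookup ≢cs (∈-map⁺ modulus c∈))
... | no _ = residueOf-∈ u c∈

coveringNumber⇒covers : ∀ {L} → IsCoveringNumber L → ∃ (Covers L)
coveringNumber⇒covers (_ , cs , cov , all) = residueOf cs , λ z →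
  let c , c∈ , sat = find (IsCovering.covers cov z) in
  modulus c , modulus≥2 c , All.lookup all c∈ ,
  subst (λ x → Congruent (modulus c) z (+ x))
    (sym (residueOf-∈ (IsCovering.distinct cov) c∈)) (congruent sat)

covers⇒coveringNumber : ∀ {L r} → 0 < L → Covers L r → IsCoveringNumber L
covers⇒coveringNumber {L} {r} 0<L cov = 0<L , map toC is , record
  { distinct = subst Unique (List.map-∘ is)
      (Unique.map⁺ (+-cancelˡ-≡ 2 _ _) (Unique.filter⁺ ∣L? (Unique.upTo⁺ L)))
  ; covers = λ z → covers′ z (cov z)
  } , All.map⁺ (All.all-filter ∣L? (upTo L))
  where
  -- Shifting by 2 makes every modulus at least 2, and the injectivity of the shift makes the moduli
  -- distinct.
  toC : ℕ → Congruence
  toC i = record { residue = r (2 + i) ; modulus = 2 + i ; modulus≥2 = s≤s (s≤s z≤n) }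
  ∣L? : ∀ i → Dec (2 + i ∣ L)
  ∣L? i = (2 + i) ∣? L
  is : List ℕ
  is = filter ∣L? (upTo L)
  covers′ : ∀ z → (∃ λ d → 2 ℕ.≤ d × d ∣ L × Congruent d z (+ r d)) →
            Any (z Satisfies_) (map toC is)
  covers′ z (suc zero , s≤s () , _)
  covers′ z (suc (suc i) , _ , d∣L , congruent sat) = lose
    (∈-map⁺ toC (∈-filter⁺ ∣L? (∈-upTo⁺ (<-trans ≤-refl (∣⇒≤ {{>-nonZero 0<L}} d∣L))) d∣L)) sat

coveringNumber-∣ : ∀ {d L} → 0 < L → d ∣ L → IsCoveringNumber d → IsCoveringNumber L
coveringNumber-∣ 0<L d∣L (_ , cs , cov , all) =
  0<L , cs , cov , All.map (λ m∣d → ∣-trans m∣d d∣L) all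

-- Deciding whether a number is a covering number

vec-any? : ∀ {m} n {P : Vec (Fin m) n → Set} → (∀ v → Dec (P v)) → Dec (∃ P)
vec-any? zero    P? = map′ (λ p → [] , p) (λ { ([] , p) → p }) (P? [])
vec-any? (suc n) P? = map′ (λ { (x , v , p) → x ∷ v , p }) (λ { (x ∷ v , p) → x , v , p })
  (Fin.any? (λ x → vec-any? n (λ v → P? (x ∷ v))))

module _ (L : ℕ) .{{_ : NonZero L}} where

  -- For divisors of `L`, integers and residues matter only mod `L`, and no divisor exceeds `L`; so
  -- a finite search over assignments suffices.
  FinitelyCovers : Vec (Fin L) (suc L) → Set
  FinitelyCovers v = ∀ (z : Fin L) → ∃ λ (d : Fin (suc L)) →
    2 ℕ.≤ toℕ d × toℕ d ∣ L × Congruent (toℕ d) (+ toℕ z) (+ toℕ (lookup v d))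

  finitelyCovers? : ∀ v → Dec (FinitelyCovers v)
  finitelyCovers? v = Fin.all? λ z → Fin.any? λ d →
    (2 ≤? toℕ d) ×-dec ((toℕ d ∣? L) ×-dec congruent? (toℕ d) _ _)

  covers⇒finitelyCovers : ∀ {r} → Covers L r → ∃ FinitelyCovers
  covers⇒finitelyCovers {r} cov = tabulate f , λ z → go z (cov (+ toℕ z))
    where
    f : Fin (suc L) → Fin L
    f d = fromℕ< (n%ℕd<d (+ r (toℕ d)) L)
    go : ∀ z → (∃ λ d → 2 ℕ.≤ d × d ∣ L × Congruent d (+ toℕ z) (+ r d)) →
         ∃ λ (d : Fin (suc L)) → 2 ℕ.≤ toℕ d × toℕ d ∣ L ×
           Congruent (toℕ d) (+ toℕ z) (+ toℕ (lookup (tabulate f) d))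
    go z (d , 2≤d , d∣L , c) with fromℕ< (s≤s (∣⇒≤ d∣L)) | toℕ-fromℕ< (s≤s (∣⇒≤ d∣L))
    ... | d′ | refl = d′ , 2≤d , d∣L ,
      subst (λ x → Congruent d (+ toℕ z) (+ x))
        (sym (trans (cong toℕ (lookup∘tabulate f d′)) (toℕ-fromℕ< _)))
        (congruent-trans c (congruent-∣ d∣L (congruent-%ℕ (+ r d) L)))

  finitelyCovers⇒covers : ∀ {v} → FinitelyCovers v → ∃ (Covers L)
  finitelyCovers⇒covers {v} cov = r , λ z →
    let z%L = fromℕ< (n%ℕd<d z L)
        d , 2≤d , d∣L , c = cov z%L in
    toℕ d , 2≤d , d∣L , congruent-trans (congruent-∣ d∣L (congruent-%ℕ z L))
      (subst₂ (λ x y → Congruent (toℕ d) (+ x) (+ y)) (toℕ-fromℕ< (n%ℕd<d z L)) (sym (r-toℕ d)) c)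
    where
    r : ℕ → ℕ
    r d with d <? suc L
    ... | yes d<  = toℕ (lookup v (fromℕ< d<))
    ... | no  _ = 0
    r-toℕ : ∀ d → r (toℕ d) ≡ toℕ (lookup v d)
    r-toℕ d with toℕ d <? suc L
    ... | yes d< = cong (toℕ ∘ lookup v) (fromℕ<-toℕ d d<)
    ... | no d≮ = contradiction (toℕ<n d) d≮

  -- The least covering exponent `β` is later found by search, with this as the test.
  coveringNumber? : Dec (IsCoveringNumber L)
  coveringNumber? = map′
    (λ { (v , cov) → covers⇒coveringNumber (>-nonZero⁻¹ L) (proj₂ (finitelyCovers⇒covers {v} cov)) })
    (λ cn → covers⇒finitelyCovers (proj₂ (coveringNumber⇒covers cn)))
    (vec-any? (suc L) finitelyCovers?)

-- Divisors of products of primes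

congruent-+⇒∣ : ∀ {d} x n → Congruent d (x ℤ.+ + n) x → d ∣ n
congruent-+⇒∣ {d} x n (congruent p) = subst (λ z → d ∣ ℤ.∣ z ∣) (lem x (+ n)) p
  where
  lem : ∀ x n → (x ℤ.+ n) ℤ.- x ≡ n
  lem = ℤ-Ring.solve-∀

∣⇒congruent-+ : ∀ {d} x n → d ∣ n → Congruent d (x ℤ.+ + n) x
∣⇒congruent-+ {d} x n p = congruent (subst (λ z → d ∣ ℤ.∣ z ∣) (sym (lem x (+ n))) p)
  where
  lem : ∀ x n → (x ℤ.+ n) ℤ.- x ≡ n
  lem = ℤ-Ring.solve-∀

^-monoʳ-∣ : ∀ m {i j} → i ℕ.≤ j → m ^ i ∣ m ^ j
^-monoʳ-∣ m {i} i≤j with m≤n⇒∃[o]m+o≡n i≤j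
... | k , refl = subst (m ^ i ∣_) (sym (^-distribˡ-+-* m i k)) (m∣m*n (m ^ k))

prime∤⇒coprime : ∀ {p n} → Prime p → ¬ p ∣ n → Coprime p n
prime∤⇒coprime pp p∤n (i∣p , i∣n) with prime⇒irreducible pp i∣p
... | inj₁ refl = refl
... | inj₂ refl = contradiction i∣n p∤n

prime∣prime⇒≡ : ∀ {p q} → Prime p → Prime q → p ∣ q → p ≡ q
prime∣prime⇒≡ pp pq p∣q with prime⇒irreducible pq p∣q
... | inj₁ refl = contradiction pp ¬prime[1]
... | inj₂ eq = eq

prime∣^⇒∣ : ∀ {p m} n → Prime p → p ∣ m ^ n → p ∣ m
prime∣^⇒∣ zero pp p∣1 = contradiction (subst Prime (∣1⇒≡1 p∣1) pp) ¬prime[1]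
prime∣^⇒∣ {m = m} (suc n) pp p∣ with euclidsLemma m (m ^ n) pp p∣
... | inj₁ p∣m = p∣m
... | inj₂ p∣m^n = prime∣^⇒∣ n pp p∣m^n

odd-prime∤2^ : ∀ {p} n → Prime p → p ≢ 2 → ¬ p ∣ 2 ^ n
odd-prime∤2^ n pp p≢2 p∣ = p≢2 (prime∣prime⇒≡ pp prime[2] (prime∣^⇒∣ n pp p∣))

∣-prime*⁻ : ∀ {p} n {d} → Prime p → d ∣ p * n → d ∣ n ⊎ ∃ λ e → d ≡ p * e × e ∣ n
∣-prime*⁻ {p} n {d} pp d∣pn with p ∣? d
... | no p∤d = inj₁ (coprime-divisor (Coprime.sym (prime∤⇒coprime pp p∤d)) d∣pn)
... | yes (divides e refl) = inj₂ (e , *-comm e p ,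
  *-cancelˡ-∣ p {{prime⇒nonZero pp}} (subst (_∣ p * n) (*-comm e p) d∣pn))

∣-2^*⁻ : ∀ γ {m d} → d ∣ 2 ^ γ * m → ∃₂ λ i e → i ℕ.≤ γ × e ∣ m × d ≡ 2 ^ i * e
∣-2^*⁻ zero {m} {d} d∣ =
  0 , d , z≤n , subst (d ∣_) (*-identityˡ m) d∣ , sym (*-identityˡ d)
∣-2^*⁻ (suc γ) {m} {d} d∣
  with ∣-prime*⁻ (2 ^ γ * m) prime[2] (subst (d ∣_) (*-assoc 2 (2 ^ γ) m) d∣)
... | inj₁ d∣′ = let i , e , i≤γ , e∣m , eq = ∣-2^*⁻ γ d∣′ in i , e , m≤n⇒m≤1+n i≤γ , e∣m , eq
... | inj₂ (d′ , refl , d′∣) =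
  let i , e , i≤γ , e∣m , eq = ∣-2^*⁻ γ d′∣ in
  suc i , e , s≤s i≤γ , e∣m , trans (cong (2 *_) eq) (sym (*-assoc 2 (2 ^ i) e))

-- The numbers 2^γ p are not covering numbers

-- Each power of two rules out only one of the two lifts of h to the next modulus.
uncoveredByPowersOf2 : ∀ (r : ℕ → ℕ) γ → ∃ λ h → ∀ i → 1 ℕ.≤ i → i ℕ.≤ γ →
                       ¬ Congruent (2 ^ i) h (+ r (2 ^ i))
uncoveredByPowersOf2 r zero = + 0 , λ i 1≤i i≤0 _ → <⇒≱ 1≤i i≤0
uncoveredByPowersOf2 r (suc γ) with uncoveredByPowersOf2 r γ
... | h , ¬h with congruent? (2 ^ suc γ) h (+ r (2 ^ suc γ))
...   | no ¬c = h , λ i 1≤i i≤ → case m≤n⇒m<n∨m≡n i≤ of λ where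
  (inj₁ i<) → ¬h i 1≤i (s≤s⁻¹ i<)
  (inj₂ refl) → ¬c
-- The new modulus meets this lift, so the other one is taken; the two agree mod `2 ^ γ`.
...   | yes c = h ℤ.+ + (2 ^ γ) , λ i 1≤i i≤ c′ → case m≤n⇒m<n∨m≡n i≤ of λ where
  (inj₁ i<) → ¬h i 1≤i (s≤s⁻¹ i<) (congruent-trans
    (congruent-sym (∣⇒congruent-+ h (2 ^ γ) (^-monoʳ-∣ 2 (s≤s⁻¹ i<)))) c′)
  -- If the class contained both lifts, `2 ^ suc γ` would divide `2 ^ γ`.
  (inj₂ refl) → <⇒≱ (^-monoʳ-< 2 ≤-refl (n<1+n γ))
    (∣⇒≤ {{m^n≢0 2 γ}} (congruent-+⇒∣ h (2 ^ γ) (congruent-trans c′ (congruent-sym c))))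

-- On the uncovered class h mod 2^γ, identified with ℤ, each modulus 2^i p meets
-- one class mod p, and there are too few such moduli.
2^γp-notCovering : ∀ {γ p} → Prime p → p ≢ 2 → suc γ < p → ¬ IsCoveringNumber (2 ^ γ * p)
2^γp-notCovering {γ} {p} pp p≢2 γ<p cn with coveringNumber⇒covers cn
... | r , cov with uncoveredByPowersOf2 r γ
-- Among the `p` points `z t`, two share one of the `suc γ` possible exponents `i`.
...   | h , ¬h = clash (pigeonhole γ<p (λ t → fromℕ< (s≤s (proj₁ (proj₂ (index (toℕ t)))))))
  where
  z : ℕ → ℤ
  z t = h ℤ.+ + (2 ^ γ * t)
  index : ∀ t → ∃ λ i → i ℕ.≤ γ × Congruent (2 ^ i * p) (z t) (+ r (2 ^ i * p))
  index t with cov (z t)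
  ... | d , 2≤d , d∣L , c with ∣-2^*⁻ γ d∣L
  ...   | i , e , i≤γ , e∣p , refl with prime⇒irreducible pp e∣p
  ...     | inj₂ refl = i , i≤γ , c
  -- A bare power of two is excluded because `z t` agrees with `h` mod `2 ^ γ`; here `i` is nonzero
  -- since `2 ≤ d`.
  ...     | inj₁ refl rewrite *-identityʳ (2 ^ i) = contradiction
    (congruent-trans (congruent-sym (∣⇒congruent-+ h (2 ^ γ * t)
      (∣m⇒∣m*n t (^-monoʳ-∣ 2 i≤γ)))) c)
    (¬h i (n≢0⇒n>0 λ { refl → <⇒≱ 2≤d ≤-refl }) i≤γ)
  clash : (∃₂ λ t t′ → t Fin.< t′ × fromℕ< (s≤s (proj₁ (proj₂ (index (toℕ t))))) ≡
                       fromℕ< (s≤s (proj₁ (proj₂ (index (toℕ t′)))))) → _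
  clash (t , t′ , t<t′ , eq) with index (toℕ t) | index (toℕ t′)
  -- Equal exponents put both points into one class mod `p`, so `p` divides `2 ^ γ * suc k`, where
  -- `suc k` is `t′ - t` and thus less than `p`.
  ... | i , i≤γ , c | i′ , i′≤γ , c′
      with refl ← trans (sym (toℕ-fromℕ< (s≤s i≤γ))) (trans (cong toℕ eq) (toℕ-fromℕ< (s≤s i′≤γ)))
      with k , t+1+k≡t′ ← m≤n⇒∃[o]m+o≡n t<t′
      with euclidsLemma (2 ^ γ) (suc k) pp (congruent-+⇒∣ (z (toℕ t)) (2 ^ γ * suc k)
        (subst (λ x → Congruent p x (z (toℕ t))) z′≡ (congruent-∣ (n∣m*n (2 ^ i))
          (congruent-trans c′ (congruent-sym c)))))
      where
      z′≡ : z (toℕ t′) ≡ z (toℕ t) ℤ.+ + (2 ^ γ * suc k)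
      z′≡ = trans (cong (λ x → h ℤ.+ + x) (trans
        (cong (2 ^ γ *_) (trans (sym t+1+k≡t′) (sym (+-suc (toℕ t) k))))
        (*-distribˡ-+ (2 ^ γ) (toℕ t) (suc k))))
        (sym (ℤ.+-assoc h (+ (2 ^ γ * toℕ t)) (+ (2 ^ γ * suc k))))
  ... | inj₁ p∣2^γ = odd-prime∤2^ γ pp p≢2 p∣2^γ
  ... | inj₂ p∣1+k = <⇒≱ (toℕ<n t′) (≤-trans (∣⇒≤ p∣1+k) (≤-trans (m≤n+m (suc k) (toℕ t))
    (≤-reflexive (trans (+-suc (toℕ t) k) t+1+k≡t′))))

-- The Chinese remainder theorem

coprime-∣-* : ∀ {m n k} → Coprime m n → m ∣ k → n ∣ k → m * n ∣ k
coprime-∣-* {m} {n} cop (divides c refl) n∣cm =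
  subst (_∣ c * m) (*-comm n m) (*-monoˡ-∣ m
    (coprime-divisor (Coprime.sym cop) (subst (n ∣_) (*-comm c m) n∣cm)))

congruent-* : ∀ {m n x y} → Coprime m n → Congruent m x y → Congruent n x y → Congruent (m * n) x y
congruent-* cop (congruent p) (congruent q) = congruent (coprime-∣-* cop p q)

congruent-≡+* : ∀ {d x y} w → x ≡ y ℤ.+ w ℤ.* + d → Congruent d x y
congruent-≡+* w refl = congruent-+* _ w

-- Bézout over ℕ has two cases according to sign; over ℤ they merge into one identity.
inverse-mod : ∀ {m n} → Coprime m n → ∃₂ λ w v → w ℤ.* + m ≡ + 1 ℤ.+ v ℤ.* + n
inverse-mod {m} {n} cop with coprime-Bézout cop
... | Bézout.+- x y eq = + x , + y ,
  trans (sym (ℤ.pos-* x m)) (trans (cong +_ (sym eq)) (cong (ℤ._+_ (+ 1)) (ℤ.pos-* y n)))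
... | Bézout.-+ x y eq = ℤ.- + x , ℤ.- + y ,
  lem (+ x) (+ y) (+ m) (+ n)
    (trans (cong (ℤ._+_ (+ 1)) (sym (ℤ.pos-* x m))) (trans (cong +_ eq) (ℤ.pos-* y n)))
  where
  lem₁ : ∀ x m → ℤ.- x ℤ.* m ≡ + 1 ℤ.- (+ 1 ℤ.+ x ℤ.* m)
  lem₁ = ℤ-Ring.solve-∀
  lem₂ : ∀ y n → + 1 ℤ.- y ℤ.* n ≡ + 1 ℤ.+ ℤ.- y ℤ.* n
  lem₂ = ℤ-Ring.solve-∀
  lem : ∀ x y m n → + 1 ℤ.+ x ℤ.* m ≡ y ℤ.* n → ℤ.- x ℤ.* m ≡ + 1 ℤ.+ ℤ.- y ℤ.* n
  lem x y m n e = trans (lem₁ x m) (trans (cong (ℤ._-_ (+ 1)) e) (lem₂ y n))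

-- In `U`, the term `(b - a) w m` vanishes mod `m` and equals `b - a` mod `n`, as `w` inverts `m`
-- there. Reducing `U` mod `m * n` makes the witness a natural number.
chineseRemainder : ∀ {m n} .{{_ : NonZero (m * n)}} → Coprime m n → ∀ a b →
                   ∃ λ u → Congruent m (+ u) (+ a) × Congruent n (+ u) (+ b)
chineseRemainder {m} {n} cop a b with inverse-mod cop
... | w , v , eq = U %ℕ (m * n) ,
  congruent-trans (congruent-∣ (m∣m*n n) (congruent-sym (congruent-%ℕ U (m * n))))
    (congruent-≡+* ((+ b ℤ.- + a) ℤ.* w) (lem₁ (+ a) (+ b) w (+ m))) ,
  congruent-trans (congruent-∣ (n∣m*n m) (congruent-sym (congruent-%ℕ U (m * n))))
    (congruent-≡+* ((+ b ℤ.- + a) ℤ.* v) (trans (cong (λ x → + a ℤ.+ (+ b ℤ.- + a) ℤ.* x) eq)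
      (lem₂ (+ a) (+ b) v (+ n))))
  where
  U : ℤ
  U = + a ℤ.+ (+ b ℤ.- + a) ℤ.* (w ℤ.* + m)
  lem₁ : ∀ a b w m → a ℤ.+ (b ℤ.- a) ℤ.* (w ℤ.* m) ≡ a ℤ.+ (b ℤ.- a) ℤ.* w ℤ.* m
  lem₁ = ℤ-Ring.solve-∀
  lem₂ : ∀ a b v n → a ℤ.+ (b ℤ.- a) ℤ.* (+ 1 ℤ.+ v ℤ.* n) ≡ b ℤ.+ (b ℤ.- a) ℤ.* v ℤ.* n
  lem₂ = ℤ-Ring.solve-∀

-- A covering with moduli dividing 2^b p q

-- The first alternative is the part of ℤ left uncovered by the classes 2^i mod 2^(i+1).
twoAdic : ∀ b z → (∃ λ t → z ≡ + (2 ^ b) ℤ.* t) ⊎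
                  (∃ λ i → i < b × Congruent (2 ^ suc i) z (+ (2 ^ i)))
twoAdic zero z = inj₁ (z , sym (ℤ.*-identityˡ z))
twoAdic (suc b) z with twoAdic b z
... | inj₂ (i , i<b , c) = inj₂ (i , m≤n⇒m≤1+n i<b , c)
-- An even `t` stays in the uncovered part; an odd `t` puts `2 ^ b * t` into the class `2 ^ b` mod
-- `2 ^ suc b`.
... | inj₁ (t , refl) with t %ℕ 2 | n%ℕd<d t 2 | a≡a%ℕn+[a/ℕn]*n t 2
...   | 0 | _ | eq = inj₁ (t /ℕ 2 , trans (cong (+ (2 ^ b) ℤ.*_) eq)
          (trans (lem (+ (2 ^ b)) (t /ℕ 2)) (cong (ℤ._* (t /ℕ 2)) (sym (ℤ.pos-* 2 (2 ^ b))))))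
  where
  lem : ∀ x y → x ℤ.* (+ 0 ℤ.+ y ℤ.* + 2) ≡ + 2 ℤ.* x ℤ.* y
  lem = ℤ-Ring.solve-∀
...   | 1 | _ | eq = inj₂ (b , ≤-refl , congruent-≡+* (t /ℕ 2) (trans (cong (+ (2 ^ b) ℤ.*_) eq)
          (trans (lem (+ (2 ^ b)) (t /ℕ 2)) (cong (λ x → + (2 ^ b) ℤ.+ (t /ℕ 2) ℤ.* x) (sym (ℤ.pos-* 2 (2 ^ b)))))))
  where
  lem : ∀ x y → x ℤ.* (+ 1 ℤ.+ y ℤ.* + 2) ≡ x ℤ.+ y ℤ.* (+ 2 ℤ.* x)
  lem = ℤ-Ring.solve-∀
...   | suc (suc _) | s≤s (s≤s ()) | _

-- Write p = b + 1 + e and q = b + 1 + f.  On 2^b ℤ, the moduli 2^i p and 2^i q with i ≤ b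
-- take care of the classes 0, …, b mod p and mod q, and each modulus 2^i p q of one of
-- the remaining e f classes mod p q.
module _ {b p q e f : ℕ} (pp : Prime p) (pq : Prime q) (p≢2 : p ≢ 2) (q≢2 : q ≢ 2) (p≢q : p ≢ q)
         (p≡ : p ≡ suc b + e) (q≡ : q ≡ suc b + f) (ef≤1+b : e * f ℕ.≤ suc b) .{{_ : NonZero f}} where

  private
    instance
      p≢0 : NonZero p
      p≢0 = prime⇒nonZero pp
      q≢0 : NonZero q
      q≢0 = prime⇒nonZero pq
      pq≢0 : NonZero (p * q)
      pq≢0 = m*n≢0 p q

    coprime : Coprime p q
    coprime = prime∤⇒coprime pp (p≢q ∘ prime∣prime⇒≡ pp pq)

    -- The classes left over form a grid of `e` rows and `f` columns; `u i` lies in its `i`th cell,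
    -- counted row by row.
    u : ℕ → ℕ
    u i = proj₁ (chineseRemainder coprime (suc b + i / f) (suc b + i % f))

    -- Which of `p` and `q` divide `d` tells the four kinds of divisors apart, and the logarithm of
    -- the cofactor recovers the exponent `i`. The factor `2 ^ b` carries a class of `t` to one of
    -- `2 ^ b * t`; for a power of two, `d / 2` is the class used in `twoAdic`.
    decode : ∀ d → Dec (p ∣ d) → Dec (q ∣ d) → ℕ
    decode d (yes _) (yes _) = 2 ^ b * u ⌊log₂ d / (p * q) ⌋
    decode d (yes _) (no  _) = 2 ^ b * ⌊log₂ d / p ⌋
    decode d (no  _) (yes _) = 2 ^ b * ⌊log₂ d / q ⌋
    decode d (no  _) (no  _) = d / 2

    r : ℕ → ℕ
    r d = decode d (p ∣? d) (q ∣? d)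

    log-quotient : ∀ i n .{{_ : NonZero n}} → ⌊log₂ 2 ^ i * n / n ⌋ ≡ i
    log-quotient i n = trans (cong ⌊log₂_⌋ (m*n/n≡m (2 ^ i) n)) (⌊log₂[2^n]⌋≡n i)

    r-2^i : ∀ i → r (2 ^ suc i) ≡ 2 ^ i
    r-2^i i with p ∣? (2 ^ suc i) | q ∣? (2 ^ suc i)
    ... | yes p∣ | _ = contradiction p∣ (odd-prime∤2^ (suc i) pp p≢2)
    ... | no _ | yes q∣ = contradiction q∣ (odd-prime∤2^ (suc i) pq q≢2)
    ... | no _ | no _ = trans (cong (_/ 2) (*-comm 2 (2 ^ i))) (m*n/n≡m (2 ^ i) 2)

    ∤-2^i* : ∀ i {x y} → Prime x → Prime y → x ≢ 2 → x ≢ y → ¬ x ∣ 2 ^ i * y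
    ∤-2^i* i {x} {y} px py x≢2 x≢y x∣ with euclidsLemma (2 ^ i) y px x∣
    ... | inj₁ x∣2^i = odd-prime∤2^ i px x≢2 x∣2^i
    ... | inj₂ x∣y = x≢y (prime∣prime⇒≡ px py x∣y)

    r-2^ip : ∀ i → r (2 ^ i * p) ≡ 2 ^ b * i
    r-2^ip i with p ∣? (2 ^ i * p) | q ∣? (2 ^ i * p)
    ... | no p∤ | _ = contradiction (n∣m*n (2 ^ i)) p∤
    ... | yes _ | yes q∣ = contradiction q∣ (∤-2^i* i pq pp q≢2 (p≢q ∘ sym))
    ... | yes _ | no _ = cong (2 ^ b *_) (log-quotient i p)

    r-2^iq : ∀ i → r (2 ^ i * q) ≡ 2 ^ b * i
    r-2^iq i with p ∣? (2 ^ i * q) | q ∣? (2 ^ i * q)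
    ... | _ | no q∤ = contradiction (n∣m*n (2 ^ i)) q∤
    ... | yes p∣ | yes _ = contradiction p∣ (∤-2^i* i pp pq p≢2 p≢q)
    ... | no _ | yes _ = cong (2 ^ b *_) (log-quotient i q)

    r-2^ipq : ∀ i → r (2 ^ i * (p * q)) ≡ 2 ^ b * u i
    r-2^ipq i with p ∣? (2 ^ i * (p * q)) | q ∣? (2 ^ i * (p * q))
    ... | no p∤ | _ = contradiction (∣n⇒∣m*n (2 ^ i) (m∣m*n q)) p∤
    ... | yes _ | no q∤ = contradiction (∣n⇒∣m*n (2 ^ i) (n∣m*n p)) q∤
    ... | yes _ | yes _ = cong (λ j → 2 ^ b * u j) (log-quotient i (p * q))

    -- Multiplication by `2 ^ b` raises the modulus to `2 ^ b * m`, of which `2 ^ i * m` is a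
    -- divisor.
    congruent-hole : ∀ {i m t x y} → i ℕ.≤ b → Congruent m t (+ x) → y ≡ 2 ^ b * x →
                     Congruent (2 ^ i * m) (+ (2 ^ b) ℤ.* t) (+ y)
    congruent-hole {m = m} {x = x} i≤b c refl = subst (Congruent _ _) (sym (ℤ.pos-* (2 ^ b) x))
      (congruent-∣ (*-monoˡ-∣ m (^-monoʳ-∣ 2 i≤b)) (congruent-*ˡ (2 ^ b) c))

    2≤2^i* : ∀ i {m} → 2 ℕ.≤ m → 2 ℕ.≤ 2 ^ i * m
    2≤2^i* i {m} 2≤m = ≤-trans 2≤m (m≤n*m m (2 ^ i) {{m^n≢0 2 i}})

    2^i*∣L : ∀ {i m} → i ℕ.≤ b → m ∣ p * q → 2 ^ i * m ∣ 2 ^ b * p * q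
    2^i*∣L {i} {m} i≤b m∣ = subst (2 ^ i * m ∣_) (sym (*-assoc (2 ^ b) p q))
      (*-pres-∣ (^-monoʳ-∣ 2 i≤b) m∣)

    2≤prime : ∀ {x} → Prime x → 2 ℕ.≤ x
    2≤prime px = nonTrivial⇒n>1 _ {{prime⇒nonTrivial px}}

    r-covers : Covers (2 ^ b * p * q) r
    r-covers z with twoAdic b z
    ... | inj₂ (i , i<b , c) = 2 ^ suc i , *-monoʳ-≤ 2 (m^n>0 2 i) ,
      subst (_∣ 2 ^ b * p * q) (*-identityʳ (2 ^ suc i)) (2^i*∣L i<b (1∣ (p * q))) ,
      subst (Congruent _ z ∘ +_) (sym (r-2^i i)) c
    -- A residue `x ≤ b` of `t` mod `p` serves as its own exponent, and so does a residue mod `q`.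
    ... | inj₁ (t , refl) with t %ℕ p <? suc b
    ...   | yes x≤b = 2 ^ x * p , 2≤2^i* x (2≤prime pp) , 2^i*∣L (s≤s⁻¹ x≤b) (m∣m*n q) ,
      congruent-hole (s≤s⁻¹ x≤b) (congruent-%ℕ t p) (r-2^ip x)
      where x = t %ℕ p
    ...   | no x≰b with t %ℕ q <? suc b
    ...     | yes y≤b = 2 ^ y * q , 2≤2^i* y (2≤prime pq) , 2^i*∣L (s≤s⁻¹ y≤b) (n∣m*n p) ,
      congruent-hole (s≤s⁻¹ y≤b) (congruent-%ℕ t q) (r-2^iq y)
      where y = t %ℕ q
    -- From here on `x` and `y` are the excesses of the two residues over `suc b`, that is, row and
    -- column in the grid.
    ...     | no y≰b with m≤n⇒∃[o]m+o≡n (≮⇒≥ x≰b) | m≤n⇒∃[o]m+o≡n (≮⇒≥ y≰b)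
    ...       | x , x≡ | y , y≡ = 2 ^ i * (p * q) , 2≤2^i* i (≤-trans (2≤prime pp) (m≤m*n p q)) ,
      2^i*∣L i≤b ∣-refl ,
      congruent-hole i≤b (congruent-* coprime
        (congruent-trans (subst (Congruent p t ∘ +_) (trans (sym x≡) (cong (λ w → suc b + w) (sym i/f≡x))) (congruent-%ℕ t p))
          (congruent-sym (proj₁ (proj₂ (chineseRemainder coprime (suc b + i / f) (suc b + i % f))))))
        (congruent-trans (subst (Congruent q t ∘ +_) (trans (sym y≡) (cong (λ w → suc b + w) (sym i%f≡y))) (congruent-%ℕ t q))
          (congruent-sym (proj₂ (proj₂ (chineseRemainder coprime (suc b + i / f) (suc b + i % f)))))))
        (r-2^ipq i)
      where
      x<e : x < e
      x<e = +-cancelˡ-< (suc b) x e (subst₂ _<_ (sym x≡) p≡ (n%ℕd<d t p))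
      y<f : y < f
      y<f = +-cancelˡ-< (suc b) y f (subst₂ _<_ (sym y≡) q≡ (n%ℕd<d t q))
      -- The number of the cell is less than `e * f`, hence an admissible exponent.
      i = y + x * f
      i≤b : i ℕ.≤ b
      i≤b = s≤s⁻¹ (≤-trans (+-monoˡ-< (x * f) y<f) (≤-trans (*-monoˡ-≤ f x<e) ef≤1+b))
      i/f≡x : i / f ≡ x
      i/f≡x = trans (+-distrib-/-∣ʳ y (n∣m*n x)) (cong₂ _+_ (m<n⇒m/n≡0 y<f) (m*n/n≡m x f))
      i%f≡y : i % f ≡ y
      i%f≡y = trans ([m+kn]%n≡m%n y x f) (m<n⇒m%n≡m y<f)

  2^bpq-coveringNumber : IsCoveringNumber (2 ^ b * p * q)
  2^bpq-coveringNumber = covers⇒coveringNumber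
    (>-nonZero⁻¹ _ {{m*n≢0 (2 ^ b * p) q {{m*n≢0 (2 ^ b) p {{m^n≢0 2 b}}}}}}) r-covers

-- The enumeration of the primes

prime-∣ : ∀ n → 2 ℕ.≤ n → ∃ λ p → Prime p × p ∣ n
prime-∣ n 2≤n with factorise n {{>-nonZero (<-trans z<s 2≤n)}}
... | record { factors = [] ; isFactorisation = refl } = contradiction 2≤n (<⇒≱ ≤-refl)
... | record { factors = p ∷ ps ; isFactorisation = refl ; factorsPrime = pp ∷ _ } =
  p , pp , m∣m*n _

-- Counting from 0 avoids the `NonZero` argument of `q`.
nthPrime : ℕ → ℕ
nthPrime n = q (suc n)

nthPrime-prime : ∀ n → Prime (nthPrime n)
nthPrime-prime zero = prime[2]
nthPrime-prime (suc n) = proj₁ (proj₂ (proj₂ (leastPrimeAbove (nthPrime n))))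

nthPrime-step : ∀ n → nthPrime n < nthPrime (suc n)
nthPrime-step n = proj₁ (proj₂ (leastPrimeAbove (nthPrime n)))

nthPrime-mono-≤ : ∀ {m n} → m ℕ.≤ n → nthPrime m ℕ.≤ nthPrime n
nthPrime-mono-≤ {m} m≤n with m≤n⇒∃[o]m+o≡n m≤n
... | k , refl = go k
  where
  go : ∀ k → nthPrime m ℕ.≤ nthPrime (m + k)
  go zero = ≤-reflexive (cong nthPrime (sym (+-identityʳ m)))
  go (suc k) = subst (λ n → nthPrime m ℕ.≤ nthPrime n) (sym (+-suc m k))
    (≤-trans (go k) (<⇒≤ (nthPrime-step (m + k))))

n<nthPrime : ∀ n → n < nthPrime n
n<nthPrime zero = z<s
n<nthPrime (suc n) = ≤-<-trans (n<nthPrime n) (nthPrime-step n)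

-- Descend from `nthPrime r`, which exceeds `r`: each term is the least prime above its predecessor,
-- so `r` cannot fall strictly between two of them.
prime⇒nthPrime : ∀ {r} → Prime r → ∃ λ n → nthPrime n ≡ r
prime⇒nthPrime {r} pr = go r (n<nthPrime r)
  where
  go : ∀ m → r < nthPrime m → ∃ λ n → nthPrime n ≡ r
  go zero r<2 = contradiction r<2 (≤⇒≯ (nonTrivial⇒n>1 r {{prime⇒nonTrivial pr}}))
  go (suc m) r< with <-cmp (nthPrime m) r
  ... | tri< m<r _ _ = contradiction r< (≤⇒≯ (proj₂ (proj₂ (proj₂ (leastPrimeAbove (nthPrime m)))) r m<r pr))
  ... | tri≈ _ eq _ = m , eq
  ... | tri> _ _ r<m = go m r<m

-- Counting the solutions of a decidable predicate

count : ∀ {P : ℕ → Set} → (∀ t → Dec (P t)) → ℕ → ℕ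
count P? zero = 0
count P? (suc n) with P? n
... | yes _ = suc (count P? n)
... | no  _ = count P? n

module _ {P : ℕ → Set} (P? : ∀ t → Dec (P t)) where

  count-all : ∀ n → (∀ t → t < n → P t) → n ℕ.≤ count P? n
  count-all zero _ = z≤n
  count-all (suc n) all with P? n
  ... | yes _ = s≤s (count-all n λ t t<n → all t (m≤n⇒m≤1+n t<n))
  ... | no ¬p = contradiction (all n ≤-refl) ¬p

  count-none : (∀ t → ¬ P t) → ∀ n → count P? n ≡ 0
  count-none none zero = refl
  count-none none (suc n) with P? n
  ... | yes p = contradiction p (none n)
  ... | no _ = count-none none n

  count-⊎ : ∀ {Q R : ℕ → Set} (Q? : ∀ t → Dec (Q t)) (R? : ∀ t → Dec (R t)) →
            (∀ t → P t → Q t ⊎ R t) → ∀ n → count P? n ℕ.≤ count Q? n + count R? n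
  count-⊎ Q? R? split zero = z≤n
  count-⊎ Q? R? split (suc n) with P? n | Q? n | R? n | count-⊎ Q? R? split n
  ... | no _  | yes _ | yes _ | ih = ≤-trans ih (+-mono-≤ (n≤1+n _) (n≤1+n _))
  ... | no _  | yes _ | no _  | ih = ≤-trans ih (n≤1+n _)
  ... | no _  | no _  | yes _ | ih = ≤-trans ih (+-monoʳ-≤ (count Q? n) (n≤1+n _))
  ... | no _  | no _  | no _  | ih = ih
  ... | yes _ | yes _ | yes _ | ih = s≤s (≤-trans ih (+-monoʳ-≤ (count Q? n) (n≤1+n _)))
  ... | yes _ | yes _ | no _  | ih = s≤s ih
  ... | yes _ | no _  | yes _ | ih = ≤-trans (s≤s ih) (≤-reflexive (sym (+-suc (count Q? n) _)))
  ... | yes p | no ¬q | no ¬r | ih = contradiction (split n p) [ ¬q , ¬r ]′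

  module _ {w} (spaced : ∀ {t t′} → P t → P t′ → t < t′ → t + w ℕ.≤ t′) where

    -- A window no longer than the spacing holds at most one solution; the second alternative
    -- remembers it so that a further one can be refuted.
    count-window : ∀ n v → v ℕ.≤ w → count P? (v + n) ℕ.≤ count P? n ⊎
                   (count P? (v + n) ℕ.≤ suc (count P? n) × ∃ λ t → n ℕ.≤ t × t < v + n × P t)
    count-window n zero _ = inj₁ ≤-refl
    count-window n (suc v) v<w with P? (v + n) | count-window n v (<⇒≤ v<w)
    ... | no _  | inj₁ le = inj₁ le
    ... | no _  | inj₂ (le , t , n≤t , t< , p) = inj₂ (le , t , n≤t , m≤n⇒m≤1+n t< , p)
    ... | yes p | inj₁ le = inj₂ (s≤s le , v + n , m≤n+m n v , ≤-refl , p)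
    ... | yes p′ | inj₂ (le , t , n≤t , t< , p) = contradiction v<w (≤⇒≯
      (+-cancelˡ-≤ n w v (≤-trans (+-monoˡ-≤ w n≤t) (≤-trans (spaced p p′ t<) (≤-reflexive (+-comm v n))))))

    count-spaced : ∀ m → count P? (m * w) ℕ.≤ m
    count-spaced zero = z≤n
    count-spaced (suc m) with count-window (m * w) w ≤-refl
    ... | inj₁ le = ≤-trans le (m≤n⇒m≤1+n (count-spaced m))
    ... | inj₂ (le , _) = ≤-trans le (s≤s (count-spaced m))

-- Small gaps between consecutive primes

SmallGap : ℕ → Set
SmallGap n = 2 * nthPrime (suc n) + 6 ℕ.≤ 3 * nthPrime n

-- Since 5 is the fixed point of (3x - 5)/2, a gap that is not small multiplies the prime minus 5 by
-- at least 3/2. Two such gaps give the factor 9/4, which exceeds 2.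
doubling : ∀ n X → ¬ SmallGap n → ¬ SmallGap (suc n) → X + 5 ℕ.≤ nthPrime n →
           2 * X + 5 ℕ.≤ nthPrime (2 + n)
doubling n X ¬s ¬s′ X≤ = *-cancelˡ-≤ 4 (+-cancelʳ-≤ 10 _ _ (begin
  4 * (2 * X + 5) + 10            ≤⟨ m≤m+n _ X ⟩
  4 * (2 * X + 5) + 10 + X        ≡⟨ lem₁ X ⟩
  3 * (3 * (X + 5)) ∸ 15          ≤⟨ ∸-monoˡ-≤ 15 (*-monoʳ-≤ 3 (≤-trans (*-monoʳ-≤ 3 X≤) (bad n ¬s))) ⟩
  3 * (2 * nthPrime (suc n) + 5) ∸ 15 ≡⟨ lem₂ (nthPrime (suc n)) ⟩
  2 * (3 * nthPrime (suc n))      ≤⟨ *-monoʳ-≤ 2 (bad (suc n) ¬s′) ⟩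
  2 * (2 * nthPrime (2 + n) + 5)  ≡⟨ lem₃ (nthPrime (2 + n)) ⟩
  4 * nthPrime (2 + n) + 10       ∎))
  where
  open ≤-Reasoning
  bad : ∀ n → ¬ SmallGap n → 3 * nthPrime n ℕ.≤ 2 * nthPrime (suc n) + 5
  bad n ¬s = s≤s⁻¹ (≤-trans (≰⇒> ¬s) (≤-reflexive (+-suc _ 5)))
  lem₁′ : ∀ X → 4 * (2 * X + 5) + 10 + X + 15 ≡ 3 * (3 * (X + 5))
  lem₁′ = ℕ-Ring.solve-∀
  lem₁ : ∀ X → 4 * (2 * X + 5) + 10 + X ≡ 3 * (3 * (X + 5)) ∸ 15
  lem₁ X = trans (sym (m+n∸n≡m _ 15)) (cong (_∸ 15) (lem₁′ X))
  lem₂′ : ∀ x → 3 * (2 * x + 5) ≡ 2 * (3 * x) + 15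
  lem₂′ = ℕ-Ring.solve-∀
  lem₂ : ∀ x → 3 * (2 * x + 5) ∸ 15 ≡ 2 * (3 * x)
  lem₂ x = trans (cong (_∸ 15) (lem₂′ x)) (m+n∸n≡m _ 15)
  lem₃ : ∀ x → 2 * (2 * x + 5) ≡ 4 * x + 10
  lem₃ = ℕ-Ring.solve-∀

n<2^n : ∀ n → n < 2 ^ n
n<2^n zero = z<s
n<2^n (suc n) = begin-strict
  suc n             <⟨ s≤s (n<2^n n) ⟩
  1 + 2 ^ n         ≤⟨ +-monoˡ-≤ (2 ^ n) (m^n>0 2 n) ⟩
  2 ^ n + 2 ^ n     ≡⟨ cong (λ w → 2 ^ n + w) (+-identityʳ (2 ^ n)) ⟨
  2 ^ suc n         ∎
  where open ≤-Reasoning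

-- If no gap after the kth prime is small, the primes from there on grow at least like 2^(i/2),
-- which is too fast for them to divide all the numbers E 0, …, E (T - 1): the jth of them divides at
-- most ⌈T / nthPrime (k + j)⌉ of these, and these bounds add up to less than T.
module _ (k : ℕ) (13≤ : 13 ℕ.≤ nthPrime k) where

  private
    P u K T : ℕ
    -- Every prime up to `nthPrime k` divides `P`, hence no `E t`. The size of `K` makes `E t` less
    -- than `2 ^ (3 + K)` for all `t < T`.
    P = nthPrime k !
    u = 2 + P
    K = u + u
    T = 2 ^ (2 + u)

    E : ℕ → ℕ
    E t = suc (P * suc t)

    Hit : ℕ → ℕ → Set
    Hit j t = nthPrime (k + j) ∣ E t

    Hit? : ∀ j t → Dec (Hit j t)
    Hit? j t = nthPrime (k + j) ∣? E t

    HitBelow : ℕ → ℕ → Set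
    HitBelow J t = ∃ λ j → j < J × Hit j t

    HitBelow? : ∀ J t → Dec (HitBelow J t)
    HitBelow? J t = anyUpTo? (λ j → Hit? j t) J

    ∣P⇒∤E : ∀ {p} t → Prime p → p ∣ P → ¬ p ∣ E t
    ∣P⇒∤E {p} t pp p∣P p∣E = contradiction
      (subst Prime (∣1⇒≡1 (∣m+n∣m⇒∣n (subst (p ∣_) (+-comm 1 (P * suc t)) p∣E) (∣m⇒∣m*n (suc t) p∣P))) pp)
      ¬prime[1]

    -- The prime divides `E t′ - E t`, which is `P * (t′ - t)`, but not `P`, so it divides `t′ - t`.
    -- A lower bound `w` in its place can be chosen as a divisor of `T`.
    hit-spaced : ∀ j {w} → w ℕ.≤ nthPrime (k + j) → ∀ {t t′} → Hit j t → Hit j t′ → t < t′ → t + w ℕ.≤ t′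
    hit-spaced j {w} w≤ {t} {t′} h h′ t<t′ with m≤n⇒∃[o]m+o≡n t<t′
    ... | d , refl with euclidsLemma P (suc d) (nthPrime-prime (k + j))
                          (∣m+n∣m⇒∣n (subst (nthPrime (k + j) ∣_) (lem P t d) h′) h)
      where
      lem : ∀ P t d → suc (P * suc (suc t + d)) ≡ suc (P * suc t) + P * suc d
      lem = ℕ-Ring.solve-∀
    ...   | inj₁ p∣P = contradiction h (∣P⇒∤E t (nthPrime-prime (k + j)) p∣P)
    ...   | inj₂ p∣1+d = ≤-trans (+-monoʳ-≤ t (≤-trans w≤ (∣⇒≤ p∣1+d))) (≤-reflexive (+-suc t d))

    count-hit : ∀ j m w → T ≡ m * w → w ℕ.≤ nthPrime (k + j) → count (Hit? j) T ℕ.≤ m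
    count-hit j m w eq w≤ = subst (λ n → count (Hit? j) n ℕ.≤ m) (sym eq)
      (count-spaced (Hit? j) (hit-spaced j w≤) m)

    count-step : ∀ J → count (HitBelow? (suc J)) T ℕ.≤ count (HitBelow? J) T + count (Hit? J) T
    count-step J = count-⊎ (HitBelow? (suc J)) (HitBelow? J) (Hit? J) (λ t → split t) T
      where
      split : ∀ t → HitBelow (suc J) t → HitBelow J t ⊎ Hit J t
      split t (j , j< , h) with m≤n⇒m<n∨m≡n j<
      ... | inj₁ j<J = inj₁ (j , s≤s⁻¹ j<J , h)
      ... | inj₂ refl = inj₂ h

  module _ (¬small : ∀ j → j < K * 2 → ¬ SmallGap (k + j)) where

    private
      growth : ∀ i → i ℕ.≤ K → 2 ^ (3 + i) + 5 ℕ.≤ nthPrime (k + i * 2)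
      -- The hypothesis enters as 13 = 2^3 + 5.
      growth zero _ = subst (λ n → 13 ℕ.≤ nthPrime n) (sym (+-identityʳ k)) 13≤
      growth (suc i) i<K = subst (λ n → 2 ^ (4 + i) + 5 ℕ.≤ nthPrime n) (sym (shift (i * 2)))
        (doubling (k + i * 2) (2 ^ (3 + i)) (¬small (i * 2) (<-trans (n<1+n _) i*2<))
          (subst (λ n → ¬ SmallGap n) (+-suc k (i * 2)) (¬small (1 + i * 2) i*2<))
          (growth i (<⇒≤ i<K)))
        where
        i*2< : 1 + i * 2 < K * 2
        i*2< = *-monoˡ-≤ 2 i<K
        shift : ∀ n → k + (2 + n) ≡ 2 + (k + n)
        shift n = trans (+-suc k (suc n)) (cong suc (+-suc k n))

      2^≤nthPrime : ∀ i j → i ℕ.≤ K → i * 2 ℕ.≤ j → 2 ^ (3 + i) ℕ.≤ nthPrime (k + j)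
      2^≤nthPrime i j i≤K i*2≤j = ≤-trans (m≤m+n _ 5) (≤-trans (growth i i≤K)
        (nthPrime-mono-≤ (+-monoʳ-≤ k i*2≤j)))

      -- A geometric sum: the primes of offset `i * 2` and `1 + i * 2` are at least `2 ^ (3 + i)`,
      -- so each hits at most `2 ^ l` numbers, where `suc i + l` is `u`. Together they use up half
      -- of the remaining slack `2 ^ (2 + l)` below `T / 2`.
      halving : ∀ i l → i + l ≡ u → count (HitBelow? (i * 2)) T + 2 ^ suc l ℕ.≤ 2 ^ suc u
      halving zero l refl = ≤-reflexive (cong (_+ 2 ^ suc u)
        (count-none (HitBelow? 0) (λ { t (_ , () , _) }) T))
      halving (suc i) l eq = begin
        count (HitBelow? (2 + i * 2)) T + 2 ^ suc l
          ≤⟨ +-monoˡ-≤ (2 ^ suc l) (≤-trans (count-step (1 + i * 2))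
               (+-mono-≤ (≤-trans (count-step (i * 2)) (+-monoʳ-≤ _ (few (i * 2) ≤-refl)))
                         (few (1 + i * 2) (n≤1+n _)))) ⟩
        count (HitBelow? (i * 2)) T + 2 ^ l + 2 ^ l + 2 ^ suc l
          ≡⟨ lem (count (HitBelow? (i * 2)) T) (2 ^ l) ⟩
        count (HitBelow? (i * 2)) T + 2 ^ (2 + l)
          ≤⟨ halving i (suc l) (trans (+-suc i l) eq) ⟩
        2 ^ suc u ∎
        where
        open ≤-Reasoning
        lem : ∀ c x → c + x + x + 2 * x ≡ c + 2 * (2 * x)
        lem = ℕ-Ring.solve-∀
        T≡ : T ≡ 2 ^ l * 2 ^ (3 + i)
        T≡ = trans (cong (2 ^_) (trans (cong (λ w → 2 + w) (sym eq)) (exponents i l)))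
          (^-distribˡ-+-* 2 l (3 + i))
          where
          exponents : ∀ i l → 2 + (suc i + l) ≡ l + (3 + i)
          exponents = ℕ-Ring.solve-∀
        few : ∀ j → i * 2 ℕ.≤ j → count (Hit? j) T ℕ.≤ 2 ^ l
        few j i*2≤j = count-hit j (2 ^ l) (2 ^ (3 + i)) T≡ (2^≤nthPrime i j i≤K i*2≤j)
          where
          i≤K : i ℕ.≤ K
          i≤K = ≤-trans (n≤1+n i) (≤-trans (m≤m+n (suc i) l) (≤-trans (≤-reflexive eq) (m≤m+n u u)))

      -- From offset `u * 2` on the primes exceed `T`, so each of them hits at most one number.
      tail : ∀ m → count (HitBelow? (m + u * 2)) T ℕ.≤ m + 2 ^ suc u
      tail zero = ≤-trans (m≤m+n _ 2) (halving u 0 (+-identityʳ u))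
      tail (suc m) = begin
        count (HitBelow? (suc m + u * 2)) T ≤⟨ count-step (m + u * 2) ⟩
        count (HitBelow? (m + u * 2)) T + count (Hit? (m + u * 2)) T
          ≤⟨ +-mono-≤ (tail m) (count-hit (m + u * 2) 1 T (sym (*-identityˡ T))
               (≤-trans (^-monoʳ-≤ 2 (n≤1+n (2 + u))) (2^≤nthPrime u _ (m≤m+n u u) (m≤n+m (u * 2) m)))) ⟩
        m + 2 ^ suc u + 1 ≡⟨ +-comm _ 1 ⟩
        suc m + 2 ^ suc u ∎
        where open ≤-Reasoning

      E-bound : ∀ t → t < T → E t < 2 ^ (3 + K)
      E-bound t t<T = begin-strict
        suc (P * suc t)  ≤⟨ s≤s (*-monoʳ-≤ P t<T) ⟩
        1 + P * T        ≤⟨ +-monoˡ-≤ (P * T) (m^n>0 2 (2 + u)) ⟩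
        suc P * T        ≤⟨ *-monoˡ-≤ T (n<2^n P) ⟩
        2 ^ P * T        ≡⟨ ^-distribˡ-+-* 2 P (2 + u) ⟨
        2 ^ (P + (2 + u)) <⟨ ^-monoʳ-< 2 ≤-refl (≤-trans (≤-reflexive (lem P)) (m≤n+m _ 2)) ⟩
        2 ^ (3 + K)      ∎
        where
        open ≤-Reasoning
        lem : ∀ P → suc (P + (2 + (2 + P))) ≡ 1 + ((2 + P) + (2 + P))
        lem = ℕ-Ring.solve-∀

      -- A prime factor of `E t` cannot divide `P`, so it comes at or after index `k`; from offset
      -- `K * 2` on it would be larger than `E t`.
      all-hit : ∀ t → t < T → HitBelow (K * 2) t
      all-hit t t<T with prime-∣ (E t) (s≤s (>-nonZero⁻¹ (P * suc t) {{m*n≢0 P (suc t) {{nthPrime k !≢0}}}}))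
      ... | r , pr , r∣E with prime⇒nthPrime pr
      ...   | n , refl with m≤n⇒∃[o]m+o≡n {k} {n} (≮⇒≥ n≮k)
        where
        n≮k : ¬ n < k
        n≮k n<k = ∣P⇒∤E t pr (∣-trans (n∣n! (nthPrime n) {{prime⇒nonZero pr}})
          (m≤n⇒m!∣n! (nthPrime-mono-≤ (<⇒≤ n<k)))) r∣E
          where
          n∣n! : ∀ m → .{{NonZero m}} → m ∣ m !
          n∣n! (suc m) = m∣m*n (m !)
      ...     | j , refl = j , ≰⇒> (λ K*2≤j → <⇒≱ (E-bound t t<T)
        (≤-trans (2^≤nthPrime K j ≤-refl K*2≤j) (∣⇒≤ r∣E))) , r∣E

    -- The first `u * 2` primes hit at most half of the `T` numbers, the next `u * 2` at most one
    -- each, and `u * 2` is less than the other half.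
    largeGaps-impossible : ⊥
    largeGaps-impossible = <⇒≱ (begin-strict
      count (HitBelow? (K * 2)) T         ≡⟨ cong (λ J → count (HitBelow? J) T) (*-distribʳ-+ 2 u u) ⟩
      count (HitBelow? (u * 2 + u * 2)) T ≤⟨ tail (u * 2) ⟩
      u * 2 + 2 ^ suc u                   <⟨ +-monoˡ-< (2 ^ suc u) (≤-trans (s≤s (≤-reflexive (*-comm u 2))) (*-monoʳ-< 2 (n<2^n u))) ⟩
      2 ^ suc u + 2 ^ suc u               ≡⟨ cong (λ w → 2 ^ suc u + w) (+-identityʳ (2 ^ suc u)) ⟨
      T                                   ∎) (count-all (HitBelow? (K * 2)) T all-hit)
      where open ≤-Reasoning

  smallGap : ∃ λ n → k ℕ.≤ n × SmallGap n
  smallGap with anyUpTo? (λ j → 2 * nthPrime (suc (k + j)) + 6 ≤? 3 * nthPrime (k + j)) (K * 2)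
  ... | yes (j , _ , s) = k + j , m≤m+n k j , s
  ... | no none = ⊥-elim (largeGaps-impossible λ j j< s → none (j , j< , s))

-- Primitivity

2^pq≢0 : ∀ {p q} β → Prime p → Prime q → NonZero (2 ^ β * p * q)
2^pq≢0 {p} {q} β pp pq = m*n≢0 (2 ^ β * p) q
  where instance
    _ = prime⇒nonZero pp
    _ = prime⇒nonZero pq
    _ = m*n≢0 (2 ^ β) p {{m^n≢0 2 β}}

-- A proper divisor either lacks `p` or `q`, and then divides some `2 ^ i * q` or `2 ^ i * p` with
-- `i ≤ β`, which is no covering number; or it lacks only a factor 2, and minimality of `β` applies.
2^βpq-primitive : ∀ {β p q} → Prime p → Prime q → p ≢ 2 → q ≢ 2 → suc β < p → suc β < q →
  IsCoveringNumber (2 ^ β * p * q) → (∀ {γ} → γ < β → ¬ IsCoveringNumber (2 ^ γ * p * q)) →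
  IsPrimitiveCoveringNumber (2 ^ β * p * q)
2^βpq-primitive {β} {p} {q} pp pq p≢2 q≢2 β<p β<q cn minimal = cn , proper
  where
  lift : ∀ i {e x} → Prime x → e ∣ x → IsCoveringNumber (2 ^ i * e) → IsCoveringNumber (2 ^ i * x)
  lift i {x = x} px e∣x = coveringNumber-∣
    (>-nonZero⁻¹ _ {{m*n≢0 (2 ^ i) x {{m^n≢0 2 i}} {{prime⇒nonZero px}}}}) (*-monoʳ-∣ (2 ^ i) e∣x)
  proper : ∀ d → d ∣ 2 ^ β * p * q → d ≢ 2 ^ β * p * q → ¬ IsCoveringNumber d
  proper d d∣ d≢ cnd with ∣-2^*⁻ β (subst (d ∣_) (*-assoc (2 ^ β) p q) d∣)
  ... | i , e , i≤β , e∣pq , refl with ∣-prime*⁻ q pp e∣pq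
  ...   | inj₁ e∣q = 2^γp-notCovering {i} pq q≢2 (≤-<-trans (s≤s i≤β) β<q) (lift i pq e∣q cnd)
  ...   | inj₂ (e′ , refl , e′∣q) with prime⇒irreducible pq e′∣q
  ...     | inj₁ refl = 2^γp-notCovering {i} pp p≢2 (≤-<-trans (s≤s i≤β) β<p)
              (lift i pp (∣-reflexive (*-identityʳ p)) cnd)
  ...     | inj₂ refl with m≤n⇒m<n∨m≡n i≤β
  ...       | inj₁ i<β = minimal i<β (subst IsCoveringNumber (sym (*-assoc (2 ^ i) p q)) cnd)
  ...       | inj₂ refl = d≢ (sym (*-assoc (2 ^ i) p q))

leastBelow : ∀ {P : ℕ → Set} → (∀ n → Dec (P n)) → ∀ n →
             (∃ λ m → m < n × P m × (∀ {j} → j < m → ¬ P j)) ⊎ (∀ {j} → j < n → ¬ P j)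
leastBelow P? zero = inj₂ λ ()
leastBelow P? (suc n) with leastBelow P? n
... | inj₁ (m , m<n , rest) = inj₁ (m , m≤n⇒m≤1+n m<n , rest)
... | inj₂ none with P? n
...   | yes pn = inj₁ (n , ≤-refl , pn , none)
...   | no ¬pn = inj₂ λ j≤n pj → case m≤n⇒m<n∨m≡n (s≤s⁻¹ j≤n) of λ where
  (inj₁ j<n) → none j<n pj
  (inj₂ refl) → ¬pn pj

-- Failure of Sun's condition

+≤-3⇒ : ∀ {β m} → + β ≤ + m ℤ.- + 3 → 3 + β ℕ.≤ m
-- For `m < 3` the right-hand side is negative, so no other case arises.
+≤-3⇒ {m = suc (suc (suc m))} (ℤ.+≤+ β≤m) = s≤s (s≤s (s≤s β≤m))

⇒+≤-3 : ∀ {β m} → 3 + β ℕ.≤ m → + β ≤ + m ℤ.- + 3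
⇒+≤-3 {m = suc (suc (suc m))} (s≤s (s≤s (s≤s β≤m))) = ℤ.+≤+ β≤m

2^a∣2^βm⇒a≤β : ∀ {a β m} → ¬ 2 ∣ m → 2 ^ a ∣ 2 ^ β * m → a ℕ.≤ β
2^a∣2^βm⇒a≤β {a} {β} {m} 2∤m 2^a∣ = ≮⇒≥ λ β<a → 2∤m (*-cancelˡ-∣ (2 ^ β) {{m^n≢0 2 β}}
  (subst (_∣ 2 ^ β * m) (*-comm 2 (2 ^ β)) (∣-trans (^-monoʳ-∣ 2 β<a) 2^a∣)))

¬sunCondition : ∀ {L} → HasForm2^βq[k]q[k+1] L → ¬ SunCondition L
¬sunCondition record { k = suc n ; β = β ; β≤q[k]-3 = β≤ ; L≡ = L≡ } = go
  where
  x y : ℕ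
  x = nthPrime n
  y = nthPrime (suc n)
  3+β≤x : 3 + β ℕ.≤ x
  3+β≤x = +≤-3⇒ β≤
  2<x : 2 < x
  2<x = ≤-trans (m≤m+n 3 β) 3+β≤x
  x<y : x < y
  x<y = nthPrime-step n
  px = nthPrime-prime n
  py = nthPrime-prime (suc n)
  2∤xy : ¬ 2 ∣ x * y
  2∤xy 2∣xy with euclidsLemma x y prime[2] 2∣xy
  ... | inj₁ 2∣x = <⇒≢ 2<x (prime∣prime⇒≡ prime[2] px 2∣x)
  ... | inj₂ 2∣y = <⇒≢ (<-trans 2<x x<y) (prime∣prime⇒≡ prime[2] py 2∣y)
  odd-prime∣⇒≥ : ∀ {p} → Prime p → p ≢ 2 → p ∣ 2 ^ β * (x * y) → x ℕ.≤ p
  odd-prime∣⇒≥ pp p≢2 p∣ with euclidsLemma (2 ^ β) (x * y) pp p∣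
  ... | inj₁ p∣2^ = contradiction p∣2^ (odd-prime∤2^ β pp p≢2)
  ... | inj₂ p∣xy with euclidsLemma x y pp p∣xy
  ...   | inj₁ p∣x = ≤-reflexive (sym (prime∣prime⇒≡ pp px p∣x))
  ...   | inj₂ p∣y = ≤-trans (<⇒≤ x<y) (≤-reflexive (sym (prime∣prime⇒≡ pp py p∣y)))
  go : ¬ SunCondition _
  -- The empty product would make the number 1, although `x` divides it.
  go record { r = 0 ; L≡ = L≡1 } = <⇒≱ 2<x (≤-trans
    (∣⇒≤ (subst (x ∣_) (trans (sym (trans L≡ (*-assoc (2 ^ β) x y))) L≡1) (∣n⇒∣m*n (2 ^ β) (m∣m*n y))))
    (n≤1+n 1))
  -- The Kronecker delta is 1 here, so the only inequality says that the prime is at most 1.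
  go record { r = 1 ; p = p ; primes = primes ; inequality = ineq } =
    <⇒≱ (nonTrivial⇒n>1 (p Fin.zero) {{prime⇒nonTrivial (primes Fin.zero)}})
      (≤-trans (m≤n+m∸n (p Fin.zero) 1) (≤-trans (≤-reflexive (+-comm 1 _)) (ineq Fin.zero)))
  -- The first inequality forces the first prime to be 2. The second then bounds the next prime by
  -- `2 + β`, yet this is an odd prime factor and so at least `x`.
  go record { r = suc (suc r) ; p = p ; a = a ; primes = primes ; distinct = distinct
            ; positive = positive ; L≡ = L≡∏ ; inequality = ineq } =
    <⇒≱ (≤-trans 3+β≤x (odd-prime∣⇒≥ (primes one) p₁≢2 p₁∣)) (begin
      p one                     ≤⟨ m≤n+m∸n (p one) 1 ⟩
      1 + (p one ∸ 1)           ≤⟨ s≤s (≤-trans (m≤m+n _ _) (ineq one)) ⟩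
      1 + (a Fin.zero + 1) * 1  ≡⟨ cong suc (trans (*-identityʳ _) (+-comm _ 1)) ⟩
      2 + a Fin.zero            ≤⟨ +-monoʳ-≤ 2 (2^a∣2^βm⇒a≤β 2∤xy (subst (λ p₀ → p₀ ^ a Fin.zero ∣ 2 ^ β * (x * y)) p₀≡2
                                     (subst (p Fin.zero ^ a Fin.zero ∣_) ∏≡ (m∣m*n _)))) ⟩
      2 + β                     ∎)
    where
    open ≤-Reasoning
    one : Fin (2 + r)
    one = Fin.suc Fin.zero
    ∏≡ = trans (sym L≡∏) (trans L≡ (*-assoc (2 ^ β) x y))
    p₀≡2 : p Fin.zero ≡ 2
    p₀≡2 = ≤-antisym
      (≤-trans (m≤n+m∸n (p Fin.zero) 1) (s≤s (≤-trans (m≤m+n _ 0) (ineq Fin.zero))))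
      (nonTrivial⇒n>1 (p Fin.zero) {{prime⇒nonTrivial (primes Fin.zero)}})
    p₁≢2 : p one ≢ 2
    p₁≢2 p₁≡2 with () ← distinct {Fin.zero} {one} (trans p₀≡2 (sym p₁≡2))
    p₁∣ : p one ∣ 2 ^ β * (x * y)
    p₁∣ = subst (p one ∣_) ∏≡ (∣n⇒∣m*n (p Fin.zero ^ a Fin.zero)
      (∣m⇒∣m*n _ (n∣n^m (positive one))))
      where
      n∣n^m : ∀ {n m} → 0 < m → n ∣ n ^ m
      n∣n^m {n} {suc m} _ = m∣m*n (n ^ m)

-- Infinitely many primitive covering numbers

-- At the exponent `b` the grid of leftover classes has 2 rows and `suc f` columns, and `SmallGap n`
-- says exactly that it has at most `suc b` cells. The least covering exponent is therefore at most
-- `b`.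
primitive-fromSmallGap : ∀ n b f → 3 + b ≡ nthPrime n → 2 + b + f ≡ nthPrime (suc n) →
  SmallGap n → ∃ λ β → β ℕ.≤ b × IsPrimitiveCoveringNumber (2 ^ β * nthPrime n * nthPrime (suc n))
primitive-fromSmallGap n b f 3+b≡x 2+b+f≡y small = case leastBelow coveringAt? (suc b) of λ where
    (inj₁ (β , β≤b , cn , minimal)) → β , s≤s⁻¹ β≤b ,
      2^βpq-primitive {β} px py x≢2 y≢2 (1+β<x (s≤s⁻¹ β≤b)) (<-trans (1+β<x (s≤s⁻¹ β≤b)) x<y) cn minimal
    (inj₂ none) → contradiction covering (none ≤-refl)
  where
  x y : ℕ
  x = nthPrime n
  y = nthPrime (suc n)
  px : Prime x
  px = nthPrime-prime n
  py : Prime y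
  py = nthPrime-prime (suc n)
  x<y : x < y
  x<y = nthPrime-step n
  2<x : 2 < x
  2<x = ≤-trans (m≤m+n 3 b) (≤-reflexive 3+b≡x)
  x≢2 : x ≢ 2
  x≢2 = >⇒≢ 2<x
  y≢2 : y ≢ 2
  y≢2 = >⇒≢ (<-trans 2<x x<y)
  1+β<x : ∀ {β} → β ℕ.≤ b → suc β < x
  1+β<x β≤b = ≤-trans (s≤s (s≤s (m≤n⇒m≤1+n β≤b))) (≤-reflexive 3+b≡x)
  coveringAt? : ∀ β → Dec (IsCoveringNumber (2 ^ β * x * y))
  coveringAt? β = coveringNumber? (2 ^ β * x * y) {{2^pq≢0 β px py}}
  2[1+f]≤1+b : 2 * suc f ℕ.≤ suc b
  2[1+f]≤1+b = +-cancelʳ-≤ (8 + 2 * b) _ _ (begin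
    2 * suc f + (8 + 2 * b)   ≡⟨ lem₁ b f ⟩
    2 * (2 + b + f) + 6       ≡⟨ cong (λ w → 2 * w + 6) 2+b+f≡y ⟩
    2 * y + 6                 ≤⟨ small ⟩
    3 * x                     ≡⟨ cong (3 *_) 3+b≡x ⟨
    3 * (3 + b)               ≡⟨ lem₂ b ⟩
    suc b + (8 + 2 * b)       ∎)
    where
    open ≤-Reasoning
    lem₁ : ∀ b f → 2 * suc f + (8 + 2 * b) ≡ 2 * (2 + b + f) + 6
    lem₁ = ℕ-Ring.solve-∀
    lem₂ : ∀ b → 3 * (3 + b) ≡ suc b + (8 + 2 * b)
    lem₂ = ℕ-Ring.solve-∀
  covering : IsCoveringNumber (2 ^ b * x * y)
  covering = 2^bpq-coveringNumber px py x≢2 y≢2 (<⇒≢ x<y)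
    (trans (sym 3+b≡x) (cong suc (+-comm 2 b)))
    (trans (sym 2+b+f≡y) (cong suc (sym (+-suc b f)))) 2[1+f]≤1+b

hasForm : ∀ n {β} → 3 + β ℕ.≤ nthPrime n → HasForm2^βq[k]q[k+1] (2 ^ β * nthPrime n * nthPrime (suc n))
hasForm n {β} 3+β≤x = record { k = suc n ; β = β ; β≤q[k]-3 = ⇒+≤-3 3+β≤x ; L≡ = refl }

infinitelyManyPrimitive : Infinite (λ L → IsPrimitiveCoveringNumber L × HasForm2^βq[k]q[k+1] L)
-- The index `N + 13` makes the primes exceed both `N`, as the size of `L` demands, and the bound 13
-- of `smallGap`.
infinitelyManyPrimitive N = fromSmallGap (smallGap (N + 13) (≤-trans (m≤n+m 13 N) (<⇒≤ (n<nthPrime (N + 13)))))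
  where
  pack : ∀ n {b} → N < nthPrime n → 3 + b ≡ nthPrime n →
         (∃ λ β → β ℕ.≤ b × IsPrimitiveCoveringNumber (2 ^ β * nthPrime n * nthPrime (suc n))) →
         ∃ λ L → N < L × IsPrimitiveCoveringNumber L × HasForm2^βq[k]q[k+1] L
  pack n N<x 3+b≡x (β , β≤b , prim) = 2 ^ β * nthPrime n * nthPrime (suc n) ,
    <-≤-trans (<-trans N<x (nthPrime-step n))
      (∣⇒≤ {{2^pq≢0 β (nthPrime-prime n) (nthPrime-prime (suc n))}} (n∣m*n (2 ^ β * nthPrime n))) ,
    prim , hasForm n (≤-trans (+-monoʳ-≤ 3 β≤b) (≤-reflexive 3+b≡x))
  fromSmallGap : (∃ λ n → N + 13 ℕ.≤ n × SmallGap n) →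
                 ∃ λ L → N < L × IsPrimitiveCoveringNumber L × HasForm2^βq[k]q[k+1] L
  fromSmallGap (n , N+13≤n , small) =
    let N+13<x    = ≤-<-trans N+13≤n (n<nthPrime n)
        b , 3+b≡x = m≤n⇒∃[o]m+o≡n (≤-trans (≤-trans (m≤m+n 3 10) (m≤n+m 13 N)) (<⇒≤ N+13<x))
        f , x+f≡y = m≤n⇒∃[o]m+o≡n (<⇒≤ (nthPrime-step n))
    in pack n (≤-<-trans (m≤m+n N 13) N+13<x) 3+b≡x (primitive-fromSmallGap n b (suc f) 3+b≡x
         (trans (+-suc (2 + b) f) (trans (cong (_+ f) 3+b≡x) x+f≡y)) small)

theorem4 : ∀ (δ : ℤ) → + 3 ≤ δ →
    Infinite (λ L → IsPrimitiveCoveringNumber L × HasForm2^βq[k]q[k+1] L) ×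
    (∀ L → IsPrimitiveCoveringNumber L → HasForm2^βq[k]q[k+1] L → ¬ SunCondition L) ×
    ¬ SunConjecture
theorem4 δ _ = infinitelyManyPrimitive , (λ L _ → ¬sunCondition) , λ conjecture →
  let L , _ , prim , form = infinitelyManyPrimitive 0 in ¬sunCondition form (conjecture L prim)
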